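{- For any injective map $f \colon \mathbb{N} \to \mathbb{Z}$, the image of $\left(f\left(\frac{p-1}{k_p}\right)\right)_{p \in \mathbb{P}} \in \mathbb{Z}^{\mathbb{P}}$ in $\mathscr{A}$ is transcendental over $\mathbb{Q}$.
   Context: $\mathbb{N}$ denotes the set of non-negative integers and $\mathbb{P}$ the set of prime numbers; $\mathbb{F}_p = \mathbb{Z}/p\mathbb{Z}$. For $p \in \mathbb{P}$, $k_p$ denotes the greatest odd divisor of $p-1$, so $\frac{p-1}{k_p}$ is the greatest power of $2$ dividing $p-1$. The ring $\mathscr{A}$ of integers modulo infinitely large primes is $\mathscr{A} = \prod_{p \in \mathbb{P}} \mathbb{F}_p \big/ \bigoplus_{p \in \mathbb{P}} \mathbb{F}_p$, a commutative $\mathbb{Q}$-algebra (each nonzero integer is invertible modulo all but finitely many primes). The image in $\mathscr{A}$ of a sequence of integers $(a(p))_{p \in \mathbb{P}}$ is the class of $(a(p) \bmod p)_{p \in \mathbb{P}}$. An element $\alpha \in \mathscr{A}$ is (naively) algebraic over $\mathbb{Q}$ if there is a nonzero $g \in \mathbb{Q}[x]$ with $g(\alpha) = 0$ in $\mathscr{A}$, and (naively) transcendental over $\mathbb{Q}$ otherwise. -}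

module Defs where

open import Algebra.Bundles using (CommutativeRing)
open import Algebra.Morphism.Bundles using (RingHomomorphism)
import Algebra.Properties.Group as GroupProperties
import Algebra.Properties.Ring as RingProperties
open import Data.Integer.Base as ℤ using (ℤ; +_; 0ℤ; 1ℤ)
import Data.Integer.Divisibility.Signed as ℤ∣
import Data.Integer.Properties as ℤ
open import Data.Integer.Tactic.RingSolver using (solve-∀)
open import Data.List.Base using (List; []; _∷_; _++_; filter; upTo)
open import Data.List.Extrema.Nat using (max; ⊥≤max; argmax-all; xs≤max)
open import Data.List.Membership.Propositional using (_∈_; _∉_)
open import Data.List.Membership.Propositional.Properties
  using (∈-++⁺ˡ; ∈-++⁺ʳ; ∈-filter⁺; ∈-upTo⁺)
open import Data.List.Relation.Unary.All as All using ()
open import Data.List.Relation.Unary.All.Properties using (all-filter)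
open import Data.List.Relation.Unary.Any using (Any; here; there)
open import Data.Nat.Base as ℕ using (ℕ; suc; NonZero; _≤_; _∸_; s≤s)
open import Data.Nat.Divisibility using (_∣_; _∤_; _∣?_; ∣⇒≤; ∣-trans; m∣m*n; n∣m*n; ∣1⇒≡1; 1∣_)
open import Data.Nat.GCD using (module Bézout; module GCD)
open Bézout using (result; +-; -+)
import Data.Nat.Properties as ℕ
open import Data.Nat.Primality using (Prime; prime?; euclidsLemma; prime⇒irreducible; prime⇒nonTrivial)
open import Data.Product.Base using (∃-syntax; _×_; _,_; proj₁; proj₂)
open import Data.Rational.Base as ℚ using (ℚ; 0ℚ; 1ℚ; ↥_; ↧_; ↧ₙ_)
import Data.Rational.Properties as ℚ
import Data.Rational.Unnormalised.Base as ℚᵘ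
open import Data.Sum.Base using (inj₁; inj₂)
open import Function.Base using (_∘_)
open import Level using (Level; 0ℓ; _⊔_) renaming (suc to lsuc)
open import Relation.Binary.PropositionalEquality as ≡
  using (_≡_; _≢_; refl; cong; subst)
import Relation.Binary.Reasoning.Setoid as SetoidReasoning
open import Relation.Nullary using (¬_; yes; no; recompute; contradiction)
open import Relation.Nullary.Decidable using (¬?; _×-dec_)
open import Relation.Unary using (Pred)

private
  variable
    i c ℓ ℓ′ : Level

record Ideal (R : CommutativeRing c ℓ) (ℓ′ : Level) : Set (c ⊔ ℓ ⊔ lsuc ℓ′) where
  open CommutativeRing R
  field
    Member   : Pred Carrier ℓ′
    resp     : ∀ {x y} → x ≈ y → Member x → Member y
    0-member : Member 0#
    +-closed : ∀ {x y} → Member x → Member y → Member (x + y)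
    *-closed : ∀ r {x} → Member x → Member (r * x)

-- The carrier is that of R; only the setoid equality changes, to
-- x ~ y iff x - y ∈ I.
_⁄_ : (R : CommutativeRing c ℓ) → Ideal R ℓ′ → CommutativeRing c ℓ′
R ⁄ I = record
  { Carrier = Carrier
  ; _≈_     = _~_
  ; _+_     = _+_
  ; _*_     = _*_
  ; -_      = -_
  ; 0#      = 0#
  ; 1#      = 1#
  ; isCommutativeRing = record
    { isRing = record
      { +-isAbelianGroup = record
        { isGroup = record
          { isMonoid = record
            { isSemigroup = record
              { isMagma = record
                { isEquivalence = record
                  { refl = ≈⇒~ R.refl ; sym = ~-sym ; trans = ~-trans }
                ; ∙-cong = ~-+-cong
                }
              ; assoc = λ x y z → ≈⇒~ (+-assoc x y z)
              }
            ; identity = (λ x → ≈⇒~ (+-identityˡ x)) , (λ x → ≈⇒~ (+-identityʳ x))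
            }
          ; inverse = (λ x → ≈⇒~ (-‿inverseˡ x)) , (λ x → ≈⇒~ (-‿inverseʳ x))
          ; ⁻¹-cong = ~-neg-cong
          }
        ; comm = λ x y → ≈⇒~ (+-comm x y)
        }
      ; *-cong     = ~-*-cong
      ; *-assoc    = λ x y z → ≈⇒~ (*-assoc x y z)
      ; *-identity = (λ x → ≈⇒~ (*-identityˡ x)) , (λ x → ≈⇒~ (*-identityʳ x))
      ; distrib    = (λ x y z → ≈⇒~ (distribˡ x y z)) , (λ x y z → ≈⇒~ (distribʳ x y z))
      }
    ; *-comm = λ x y → ≈⇒~ (*-comm x y)
    }
  }
  where
  module R = CommutativeRing R
  open R hiding (refl; sym; trans)
  open Ideal I
  open GroupProperties +-group using (x≈y⇒x∙y⁻¹≈ε; //-rightDividesˡ; ⁻¹-anti-homo-//)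
  open RingProperties ring using (-1*x≈-x; -‿+-comm; x[y-z]≈xy-xz; [y-z]x≈yx-zx)
  open SetoidReasoning setoid

  infix 4 _~_
  _~_ : Carrier → Carrier → Set _
  x ~ y = Member (x - y)

  ≈⇒~ : ∀ {x y} → x ≈ y → x ~ y
  ≈⇒~ x≈y = resp (R.sym (x≈y⇒x∙y⁻¹≈ε x≈y)) 0-member

  neg-closed : ∀ {x} → Member x → Member (- x)
  neg-closed {x} m = resp (-1*x≈-x x) (*-closed (- 1#) m)

  ~-sym : ∀ {x y} → x ~ y → y ~ x
  ~-sym {x} {y} m = resp (⁻¹-anti-homo-// x y) (neg-closed m)

  telescope : ∀ x y z → (x - y) + (y - z) ≈ x - z
  telescope x y z = begin
    (x - y) + (y - z) ≈⟨ +-assoc (x - y) y (- z) ⟨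
    ((x - y) + y) - z ≈⟨ +-congʳ (//-rightDividesˡ y x) ⟩
    x - z             ∎

  ~-trans : ∀ {x y z} → x ~ y → y ~ z → x ~ z
  ~-trans m n = resp (telescope _ _ _) (+-closed m n)

  interchange : ∀ x u y v → (x - y) + (u - v) ≈ (x + u) - (y + v)
  interchange x u y v = begin
    (x - y) + (u - v)       ≈⟨ +-assoc x (- y) (u - v) ⟩
    x + (- y + (u - v))     ≈⟨ +-congˡ (+-assoc (- y) u (- v)) ⟨
    x + ((- y + u) - v)     ≈⟨ +-congˡ (+-congʳ (+-comm (- y) u)) ⟩
    x + ((u - y) - v)       ≈⟨ +-congˡ (+-assoc u (- y) (- v)) ⟩
    x + (u + (- y - v))     ≈⟨ +-assoc x u (- y - v) ⟨
    (x + u) + (- y - v)     ≈⟨ +-congˡ (-‿+-comm y v) ⟩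
    (x + u) - (y + v)       ∎

  ~-+-cong : ∀ {x y u v} → x ~ y → u ~ v → (x + u) ~ (y + v)
  ~-+-cong m n = resp (interchange _ _ _ _) (+-closed m n)

  ~-neg-cong : ∀ {x y} → x ~ y → (- x) ~ (- y)
  ~-neg-cong {x} {y} m = resp (R.sym (-‿+-comm x (- y))) (neg-closed m)

  ~-*-cong : ∀ {x y u v} → x ~ y → u ~ v → (x * u) ~ (y * v)
  ~-*-cong {x} {y} {u} {v} m n = ~-trans
    (resp (R.trans (*-comm u (x - y)) ([y-z]x≈yx-zx u x y)) (*-closed u m))
    (resp (x[y-z]≈xy-xz y u v) (*-closed y n))

infixl 7 _⁄_

module _ {I : Set i} (R : I → CommutativeRing c ℓ) where
  private
    module R (j : I) = CommutativeRing (R j)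

  ∏ : CommutativeRing (i ⊔ c) (i ⊔ ℓ)
  ∏ = record
    { Carrier = ∀ j → R.Carrier j
    ; _≈_     = λ x y → ∀ j → R._≈_ j (x j) (y j)
    ; _+_     = λ x y j → R._+_ j (x j) (y j)
    ; _*_     = λ x y j → R._*_ j (x j) (y j)
    ; -_      = λ x j → R.-_ j (x j)
    ; 0#      = λ j → R.0# j
    ; 1#      = λ j → R.1# j
    ; isCommutativeRing = record
      { isRing = record
        { +-isAbelianGroup = record
          { isGroup = record
            { isMonoid = record
              { isSemigroup = record
                { isMagma = record
                  { isEquivalence = record
                    { refl  = λ j → R.refl j
                    ; sym   = λ p j → R.sym j (p j)
                    ; trans = λ p q j → R.trans j (p j) (q j)
                    }
                  ; ∙-cong = λ p q j → R.+-cong j (p j) (q j)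
                  }
                ; assoc = λ x y z j → R.+-assoc j (x j) (y j) (z j)
                }
              ; identity = (λ x j → R.+-identityˡ j (x j)) , (λ x j → R.+-identityʳ j (x j))
              }
            ; inverse = (λ x j → R.-‿inverseˡ j (x j)) , (λ x j → R.-‿inverseʳ j (x j))
            ; ⁻¹-cong = λ p j → R.-‿cong j (p j)
            }
          ; comm = λ x y j → R.+-comm j (x j) (y j)
          }
        ; *-cong     = λ p q j → R.*-cong j (p j) (q j)
        ; *-assoc    = λ x y z j → R.*-assoc j (x j) (y j) (z j)
        ; *-identity = (λ x j → R.*-identityˡ j (x j)) , (λ x j → R.*-identityʳ j (x j))
        ; distrib    = (λ x y z j → R.distribˡ j (x j) (y j) (z j))
                     , (λ x y z j → R.distribʳ j (x j) (y j) (z j))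
        }
      ; *-comm = λ x y j → R.*-comm j (x j) (y j)
      }
    }

  -- The direct sum as an ideal of the product: families vanishing
  -- outside a finite set of indices.
  ⨁ : Ideal ∏ (i ⊔ ℓ)
  ⨁ = record
    { Member   = λ x → ∃[ S ] (∀ j → j ∉ S → R._≈_ j (x j) (R.0# j))
    ; resp     = λ x≈y (S , x≈0) → S , λ j j∉S →
                   R.trans j (R.sym j (x≈y j)) (x≈0 j j∉S)
    ; 0-member = [] , λ j _ → R.refl j
    ; +-closed = λ (S , x≈0) (T , y≈0) → S ++ T , λ j j∉ →
                   R.trans j (R.+-cong j (x≈0 j (j∉ ∘ ∈-++⁺ˡ)) (y≈0 j (j∉ ∘ ∈-++⁺ʳ S)))
                             (R.+-identityˡ j (R.0# j))
    ; *-closed = λ r (S , x≈0) → S , λ j j∉S →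
                   R.trans j (R.*-congˡ j (x≈0 j j∉S)) (R.zeroʳ j (r j))
    }

-- Primality is irrelevant, so that elements of ℙ are equal as soon as the
-- underlying numbers are.
record ℙ : Set where
  constructor mkℙ
  field
    value    : ℕ
    .isPrime : Prime value

open ℙ public using (value)

prime : (p : ℙ) → Prime (value p)
prime (mkℙ p pr) = recompute (prime? p) pr

ℤ-ring : CommutativeRing 0ℓ 0ℓ
ℤ-ring = ℤ.+-*-commutativeRing

multiplesOf : ℕ → Ideal ℤ-ring 0ℓ
multiplesOf n = record
  { Member   = + n ℤ∣.∣_
  ; resp     = subst (+ n ℤ∣.∣_)
  ; 0-member = ℤ∣.divides 0ℤ refl
  ; +-closed = ℤ∣.∣m∣n⇒∣m+n
  ; *-closed = λ r → ℤ∣.∣n⇒∣m*n r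
  }

𝔽 : ℙ → CommutativeRing 0ℓ 0ℓ
𝔽 p = ℤ-ring ⁄ multiplesOf (value p)

𝒜 : CommutativeRing 0ℓ 0ℓ
𝒜 = ∏ 𝔽 ⁄ ⨁ 𝔽

-- Both quotients keep their carriers, so an integer represents its own
-- residue class and an integer sequence its own class in 𝒜.
image : (ℙ → ℤ) → CommutativeRing.Carrier 𝒜
image a = a

ℚ-ring : CommutativeRing 0ℓ 0ℓ
ℚ-ring = ℚ.+-*-commutativeRing

-- An inverse of d modulo p when p ∤ d. For p ∣ d the value is arbitrary;
-- for fixed d ≠ 0 this concerns finitely many p only.
inverse : ℙ → ℕ → ℤ
inverse p d with Bézout.lemma d (value p)
... | result _ _ (+- x _ _) = + x
... | result _ _ (-+ x _ _) = ℤ.- + x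

fromℚ : ℚ → ℙ → ℤ
fromℚ x p = ↥ x ℤ.* inverse p (↧ₙ x)

module _ (p : ℙ) where
  π : ℤ
  π = + value p

  gcd≡1 : ∀ {d g} → GCD.GCD d (value p) g → value p ∤ d → g ≡ 1
  gcd≡1 G p∤d with prime⇒irreducible (prime p) (proj₂ (GCD.GCD.commonDivisor G))
  ... | inj₁ g≡1  = g≡1
  ... | inj₂ refl = contradiction (proj₁ (GCD.GCD.commonDivisor G)) p∤d

  inverse-correct : ∀ d → value p ∤ d → π ℤ∣.∣ + d ℤ.* inverse p d ℤ.- 1ℤ
  inverse-correct d p∤d with Bézout.lemma d (value p)
  ... | result _ G (+- x y eq) with refl ← gcd≡1 G p∤d =
    ℤ∣.divides (+ y) (≡.trans (cong (ℤ._- 1ℤ) step) (shift _))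
    where
    step : + d ℤ.* + x ≡ 1ℤ ℤ.+ + y ℤ.* π
    step = ≡.trans (≡.sym (ℤ.pos-* d x))
      (≡.trans (cong +_ (≡.trans (ℕ.*-comm d x) (≡.sym eq)))
        (≡.trans (ℤ.pos-+ 1 (y ℕ.* value p)) (cong (ℤ._+_ 1ℤ) (ℤ.pos-* y (value p)))))
    shift : ∀ t → 1ℤ ℤ.+ t ℤ.- 1ℤ ≡ t
    shift = solve-∀
  ... | result _ G (-+ x y eq) with refl ← gcd≡1 G p∤d =
    ℤ∣.divides (ℤ.- + y) (≡.trans (shift (+ d) (+ x))
      (≡.trans (cong ℤ.-_ step) (ℤ.neg-distribˡ-* (+ y) π)))
    where
    step : 1ℤ ℤ.+ + x ℤ.* + d ≡ + y ℤ.* π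
    step = ≡.trans (cong (ℤ._+_ 1ℤ) (≡.sym (ℤ.pos-* x d)))
      (≡.trans (≡.sym (ℤ.pos-+ 1 (x ℕ.* d))) (≡.trans (cong +_ eq) (ℤ.pos-* y (value p))))
    shift : ∀ d x → d ℤ.* ℤ.- x ℤ.- 1ℤ ≡ ℤ.- (1ℤ ℤ.+ x ℤ.* d)
    shift = solve-∀

  cancel : ∀ d {z} → value p ∤ d → π ℤ∣.∣ + d ℤ.* z → π ℤ∣.∣ z
  cancel d {z} p∤d p∣dz
    with euclidsLemma d ℤ.∣ z ∣ (prime p)
           (subst (value p ∣_) (ℤ.abs-* (+ d) z) (ℤ∣.∣⇒∣ᵤ p∣dz))
  ... | inj₁ p∣d = contradiction p∣d p∤d
  ... | inj₂ p∣z = ℤ∣.∣ᵤ⇒∣ p∣z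

primesAmong : List ℕ → List ℙ
primesAmong []       = []
primesAmong (n ∷ ns) with prime? n
... | yes pr = mkℙ n pr ∷ primesAmong ns
... | no  _  = primesAmong ns

∈-primesAmong : ∀ p {ns} → value p ∈ ns → p ∈ primesAmong ns
∈-primesAmong p {n ∷ ns} p∈ns with prime? n
∈-primesAmong p {n ∷ ns} (here refl)  | yes _   = here refl
∈-primesAmong p {n ∷ ns} (there p∈ns) | yes _   = there (∈-primesAmong p p∈ns)
∈-primesAmong p {n ∷ ns} (here refl)  | no  ¬pr = contradiction (prime p) ¬pr
∈-primesAmong p {n ∷ ns} (there p∈ns) | no  _   = ∈-primesAmong p p∈ns

primesUpTo : ℕ → List ℙ
primesUpTo n = primesAmong (upTo (suc n))

∉⇒∤ : ∀ p d .{{_ : NonZero d}} → p ∉ primesUpTo d → value p ∤ d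
∉⇒∤ p d p∉ p∣d = p∉ (∈-primesAmong p (∈-upTo⁺ (s≤s (∣⇒≤ p∣d))))

fromℚ-correct : ∀ p x → value p ∤ ↧ₙ x →
                + value p ℤ∣.∣ ↧ x ℤ.* fromℚ x p ℤ.- ↥ x
fromℚ-correct p x@record{} p∤d =
  subst (+ value p ℤ∣.∣_) (rearrange (↥ x) (↧ x) (inverse p (↧ₙ x)))
    (ℤ∣.∣n⇒∣m*n (↥ x) (inverse-correct p (↧ₙ x) p∤d))
  where
  rearrange : ∀ n d v → n ℤ.* (d ℤ.* v ℤ.- 1ℤ) ≡ d ℤ.* (n ℤ.* v) ℤ.- n
  rearrange = solve-∀

fromℚ-neg : ∀ x p → fromℚ (ℚ.- x) p ≡ ℤ.- fromℚ x p
fromℚ-neg x p = ≡.trans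
  (≡.cong₂ (λ n d → n ℤ.* inverse p d) (ℚ.↥-neg x) (ℤ.+-injective (ℚ.↧-neg x)))
  (≡.sym (ℤ.neg-distribˡ-* (↥ x) (inverse p (↧ₙ x))))

+-cross : ∀ x y → ↥ (x ℚ.+ y) ℤ.* (↧ x ℤ.* ↧ y) ≡ (↥ x ℤ.* ↧ y ℤ.+ ↥ y ℤ.* ↧ x) ℤ.* ↧ (x ℚ.+ y)
+-cross x@record{} y@record{} with x ℚ.+ y | ℚ.toℚᵘ-homo-+ x y
... | record{} | ℚᵘ.*≡* eq = eq

*-cross : ∀ x y → ↥ (x ℚ.* y) ℤ.* (↧ x ℤ.* ↧ y) ≡ (↥ x ℤ.* ↥ y) ℤ.* ↧ (x ℚ.* y)
*-cross x@record{} y@record{} with x ℚ.* y | ℚ.toℚᵘ-homo-* x y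
... | record{} | ℚᵘ.*≡* eq = eq

module _ (x y z : ℚ) where
  dens : ℕ
  dens = ↧ₙ x ℕ.* (↧ₙ y ℕ.* ↧ₙ z)

  module _ (p : ℙ) (p∉ : p ∉ primesUpTo dens) where
    p∤ : value p ∤ dens
    p∤ = ∉⇒∤ p dens {{ℕ.m*n≢0 (↧ₙ x) (↧ₙ y ℕ.* ↧ₙ z) {{_}} {{ℕ.m*n≢0 (↧ₙ y) (↧ₙ z)}}}} p∉

    p∤x : value p ∤ ↧ₙ x
    p∤x h = p∤ (∣-trans h (m∣m*n (↧ₙ y ℕ.* ↧ₙ z)))

    p∤y : value p ∤ ↧ₙ y
    p∤y h = p∤ (∣-trans h (∣-trans (m∣m*n (↧ₙ z)) (n∣m*n (↧ₙ x))))

    p∤z : value p ∤ ↧ₙ z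
    p∤z h = p∤ (∣-trans h (∣-trans (n∣m*n (↧ₙ y)) (n∣m*n (↧ₙ x))))

    cancel₃ : ∀ {t} → + value p ℤ∣.∣ ↧ x ℤ.* (↧ y ℤ.* (↧ z ℤ.* t)) → + value p ℤ∣.∣ t
    cancel₃ = cancel p (↧ₙ z) p∤z ∘ cancel p (↧ₙ y) p∤y ∘ cancel p (↧ₙ x) p∤x

fromℚ-+ : ∀ x y p → p ∉ primesUpTo (dens x y (x ℚ.+ y)) →
          + value p ℤ∣.∣ (fromℚ (x ℚ.+ y) p ℤ.- (fromℚ x p ℤ.+ fromℚ y p)) ℤ.- 0ℤ
fromℚ-+ x y p p∉ = cancel₃ x y z p p∉ (subst (+ value p ℤ∣.∣_)
  (expand (↧ x) (↧ y) (↧ z) (↥ x) (↥ y) (↥ z) (fromℚ x p) (fromℚ y p) (fromℚ z p))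
  (ℤ∣.∣m∣n⇒∣m+n
    (ℤ∣.∣m∣n⇒∣m-n
      (ℤ∣.∣n⇒∣m*n (↧ x ℤ.* ↧ y) (fromℚ-correct p z (p∤z x y z p p∉)))
      (ℤ∣.∣n⇒∣m*n (↧ z)
        (ℤ∣.∣m∣n⇒∣m+n
          (ℤ∣.∣n⇒∣m*n (↧ y) (fromℚ-correct p x (p∤x x y z p p∉)))
          (ℤ∣.∣n⇒∣m*n (↧ x) (fromℚ-correct p y (p∤y x y z p p∉))))))
    (ℤ∣.divides 0ℤ (ℤ.i≡j⇒i-j≡0 (+-cross x y)))))
  where
  z = x ℚ.+ y
  expand : ∀ dx dy dz nx ny nz a b c →
    dx ℤ.* dy ℤ.* (dz ℤ.* c ℤ.- nz)
      ℤ.- dz ℤ.* (dy ℤ.* (dx ℤ.* a ℤ.- nx) ℤ.+ dx ℤ.* (dy ℤ.* b ℤ.- ny))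
      ℤ.+ (nz ℤ.* (dx ℤ.* dy) ℤ.- (nx ℤ.* dy ℤ.+ ny ℤ.* dx) ℤ.* dz)
    ≡ dx ℤ.* (dy ℤ.* (dz ℤ.* ((c ℤ.- (a ℤ.+ b)) ℤ.- 0ℤ)))
  expand = solve-∀

fromℚ-* : ∀ x y p → p ∉ primesUpTo (dens x y (x ℚ.* y)) →
          + value p ℤ∣.∣ (fromℚ (x ℚ.* y) p ℤ.- (fromℚ x p ℤ.* fromℚ y p)) ℤ.- 0ℤ
fromℚ-* x y p p∉ = cancel₃ x y z p p∉ (subst (+ value p ℤ∣.∣_)
  (expand (↧ x) (↧ y) (↧ z) (↥ x) (↥ y) (↥ z) (fromℚ x p) (fromℚ y p) (fromℚ z p))
  (ℤ∣.∣m∣n⇒∣m+n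
    (ℤ∣.∣m∣n⇒∣m-n
      (ℤ∣.∣n⇒∣m*n (↧ x ℤ.* ↧ y) (fromℚ-correct p z (p∤z x y z p p∉)))
      (ℤ∣.∣n⇒∣m*n (↧ z)
        (ℤ∣.∣m∣n⇒∣m+n
          (ℤ∣.∣n⇒∣m*n (↧ y ℤ.* fromℚ y p) (fromℚ-correct p x (p∤x x y z p p∉)))
          (ℤ∣.∣n⇒∣m*n (↥ x) (fromℚ-correct p y (p∤y x y z p p∉))))))
    (ℤ∣.divides 0ℤ (ℤ.i≡j⇒i-j≡0 (*-cross x y)))))
  where
  z = x ℚ.* y
  expand : ∀ dx dy dz nx ny nz a b c →
    dx ℤ.* dy ℤ.* (dz ℤ.* c ℤ.- nz)
      ℤ.- dz ℤ.* (dy ℤ.* b ℤ.* (dx ℤ.* a ℤ.- nx) ℤ.+ nx ℤ.* (dy ℤ.* b ℤ.- ny))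
      ℤ.+ (nz ℤ.* (dx ℤ.* dy) ℤ.- (nx ℤ.* ny) ℤ.* dz)
    ≡ dx ℤ.* (dy ℤ.* (dz ℤ.* ((c ℤ.- (a ℤ.* b)) ℤ.- 0ℤ)))
  expand = solve-∀

fromℚ-0 : ∀ p → fromℚ 0ℚ p ≡ 0ℤ
fromℚ-0 p = ℤ.*-zeroˡ (inverse p 1)

fromℚ-1 : ∀ p → + value p ℤ∣.∣ (fromℚ 1ℚ p ℤ.- 1ℤ) ℤ.- 0ℤ
fromℚ-1 p = subst (+ value p ℤ∣.∣_) (≡.sym (ℤ.+-identityʳ _))
  (inverse-correct p 1 (λ p∣1 → ℕ.nonTrivial⇒≢1 {{prime⇒nonTrivial (prime p)}} (∣1⇒≡1 p∣1)))

ℚ→𝒜 : RingHomomorphism (CommutativeRing.rawRing ℚ-ring) (CommutativeRing.rawRing 𝒜)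
ℚ→𝒜 = record
  { ⟦_⟧ = fromℚ
  ; isRingHomomorphism = record
    { isSemiringHomomorphism = record
      { isNearSemiringHomomorphism = record
        { +-isMonoidHomomorphism = record
          { isMagmaHomomorphism = record
            { isRelHomomorphism = record { cong = λ { {x} refl → 𝒜.refl {fromℚ x} } }
            ; homo = λ x y → primesUpTo (dens x y (x ℚ.+ y)) , fromℚ-+ x y
            }
          ; ε-homo = pointwise fromℚ-0
          }
        ; *-homo = λ x y → primesUpTo (dens x y (x ℚ.* y)) , fromℚ-* x y
        }
      ; 1#-homo = [] , λ p _ → fromℚ-1 p
      }
    ; -‿homo = λ x → pointwise (fromℚ-neg x)
    }
  }
  where
  module 𝒜 = CommutativeRing 𝒜

  pointwise : ∀ {x y : ℙ → ℤ} → (∀ p → x p ≡ y p) → x 𝒜.≈ y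
  pointwise x≡y = [] , λ p _ → ℤ∣.divides 0ℤ
    (≡.trans (ℤ.+-identityʳ _) (ℤ.i≡j⇒i-j≡0 (x≡y p)))

-- Coefficients, constant term first; trailing zeros are allowed.
ℚ[x] : Set
ℚ[x] = List ℚ

NonZeroPoly : ℚ[x] → Set
NonZeroPoly = Any (_≢ 0ℚ)

module _ (A : CommutativeRing c ℓ)
         (φ : RingHomomorphism (CommutativeRing.rawRing ℚ-ring) (CommutativeRing.rawRing A)) where
  open CommutativeRing A
  open RingHomomorphism φ using (⟦_⟧)

  eval : ℚ[x] → Carrier → Carrier
  eval []       α = 0#
  eval (q ∷ qs) α = ⟦ q ⟧ + α * eval qs α

  Algebraic : Carrier → Set ℓ
  Algebraic α = ∃[ g ] (NonZeroPoly g × eval g α ≈ 0#)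

  Transcendental : Carrier → Set ℓ
  Transcendental α = ¬ Algebraic α

Odd : ℕ → Set
Odd n = 2 ∤ n

oddDivisors : ℕ → List ℕ
oddDivisors n = filter (λ d → ¬? (2 ∣? d) ×-dec (d ∣? n)) (upTo (suc n))

-- The base value 1 of max is itself an odd divisor of n, so it does not
-- affect the result when n ≠ 0.
greatestOddDivisor : ℕ → ℕ
greatestOddDivisor n = max 1 (oddDivisors n)

greatestOddDivisor-isOddDivisor :
  ∀ n → Odd (greatestOddDivisor n) × greatestOddDivisor n ∣ n
greatestOddDivisor-isOddDivisor n =
  argmax-all (λ d → d) {P = λ d → Odd d × d ∣ n}
    ((λ 2∣1 → contradiction (∣1⇒≡1 2∣1) λ ()) , 1∣ n)
    (all-filter (λ d → ¬? (2 ∣? d) ×-dec (d ∣? n)) (upTo (suc n)))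

greatestOddDivisor-greatest :
  ∀ n .{{_ : NonZero n}} {d} → Odd d → d ∣ n → d ≤ greatestOddDivisor n
greatestOddDivisor-greatest n odd d∣n =
  All.lookup (xs≤max 1 (oddDivisors n))
    (∈-filter⁺ (λ d → ¬? (2 ∣? d) ×-dec (d ∣? n)) (∈-upTo⁺ (s≤s (∣⇒≤ d∣n))) (odd , d∣n))

greatestOddDivisor-nonZero : ∀ n → NonZero (greatestOddDivisor n)
greatestOddDivisor-nonZero n = ℕ.>-nonZero (⊥≤max 1 (oddDivisors n))

k : ℙ → ℕ
k p = greatestOddDivisor (value p ∸ 1)

k-nonZero : ∀ p → NonZero (k p)
k-nonZero p = greatestOddDivisor-nonZero (value p ∸ 1)

{-# OPTIONS --safe #-}

-- (p-1)/k_p equals 2^n for infinitely many primes p, for every n ≥ 2. Indeed,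
-- given M, let y be the odd part of M! and x = 3y⁴. Then x^(2^(n-1)) + 1 = 2K
-- with K = 1 + 2^n u and u odd. The prime factors of K are > M, as they do not
-- divide x, and ≡ 1 (mod 2^n) by Fermat's little theorem; they cannot all be
-- ≡ 1 (mod 2^(n+1)), since K is not.
--
-- If g annihilates the given element, clear its denominators. Then g(f(2^n)) is
-- divisible by infinitely many primes for each n ≥ 2, hence is 0, so that g has
-- infinitely many roots.
module Submission where

open import Defs
open import Algebra.Bundles using (CommutativeRing)
open import Algebra.Morphism.Bundles using (RingHomomorphism)
open import Algebra.Properties.CommutativeSemiring.Binomial as Binomial using ()
open import Algebra.Properties.Semiring.Sum as Sum using ()
open import Data.Fin.Base using (Fin; zero; suc; toℕ; fromℕ; inject₁)
open import Data.Fin.Properties using (toℕ<n; toℕ-fromℕ; toℕ-inject₁)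
open import Data.Integer.Base as ℤ using (ℤ; 0ℤ)
import Data.Integer.Divisibility.Signed as ℤ∣
import Data.Integer.Properties as ℤ
import Data.Integer.Tactic.RingSolver as ℤ-Solver
open import Data.List.Base using (List; []; _∷_; length; map)
open import Data.List.Extrema.Nat using (max; xs≤max)
open import Data.List.Membership.Propositional using (_∈_; _∉_)
open import Data.List.Membership.Propositional.Properties using (∈-map⁺)
open import Data.List.Relation.Unary.All as All using (All; []; _∷_)
open import Data.List.Relation.Unary.All.Properties using (All¬⇒¬Any)
open import Data.List.Relation.Unary.Any using (here; there)
open import Data.Nat.Base
open import Data.Nat.Combinatorics using (_C_; nCn≡1; nCk≡n!/k![n-k]!; k![n∸k]!∣n!)
open import Data.Nat.Coprimality using (Coprime; coprime-divisor)
open import Data.Nat.Divisibility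
open import Data.Nat.DivMod using (_/_; _%_; m≡m%n+[m/n]*n; m%n<n; m/n*n≡m; m*n/n≡m)
open import Data.Nat.Induction using (<-rec)
open import Data.Nat.ListAction using (product)
open import Data.Nat.ListAction.Properties using (∈⇒∣product)
open import Data.Nat.Primality
open import Data.Nat.Primality.Factorisation using (PrimeFactorisation; factorise)
open import Data.Nat.Properties
open import Data.Nat.Tactic.RingSolver using (solve-∀)
open import Data.Product.Base using (∃-syntax; _×_; _,_; proj₁; proj₂)
open import Data.Rational.Base using (ℚ; 0ℚ; ↥_; ↧_; ↧ₙ_)
import Data.Rational.Properties as ℚ
open import Data.Sum.Base using ([_,_]′; inj₁; inj₂)
open import Function.Base using (_∘_)
open import Function.Definitions using (Injective)
open import Relation.Binary.Definitions using (tri<; tri≈; tri>)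
open import Relation.Binary.PropositionalEquality
open import Relation.Nullary using (¬_; yes; no; contradiction)

private
  variable
    a b d p : ℕ

-- Congruence to 1.

infix 4 _≡1[mod_]

-- The quotient is a natural number, so no subtraction occurs and `a` is at least 1.
_≡1[mod_] : ℕ → ℕ → Set
a ≡1[mod d ] = ∃[ t ] a ≡ 1 + t * d

*-≡1 : a ≡1[mod d ] → b ≡1[mod d ] → a * b ≡1[mod d ]
*-≡1 {d = d} (s , refl) (t , refl) = s + t + s * t * d , expand s t d
  where
  expand : ∀ s t d → (1 + s * d) * (1 + t * d) ≡ 1 + (s + t + s * t * d) * d
  expand = solve-∀

^-≡1 : ∀ n → a ≡1[mod d ] → a ^ n ≡1[mod d ]
^-≡1 zero    a≡1 = 0 , refl
^-≡1 (suc n) a≡1 = *-≡1 a≡1 (^-≡1 n a≡1)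

-- Fermat's little theorem.

p∤m! : Prime p → ∀ m → m < p → p ∤ m !
p∤m! pr zero    _   p∣1 = nonTrivial⇒≢1 {{prime⇒nonTrivial pr}} (∣1⇒≡1 p∣1)
p∤m! pr (suc m) m<p p∣ with euclidsLemma (suc m) (m !) pr p∣
... | inj₁ p∣1+m = >⇒∤ m<p p∣1+m
... | inj₂ p∣m!  = p∤m! pr m (<-trans (n<1+n m) m<p) p∣m!

nCk*k![n∸k]!≡n! : ∀ {n k} → k ≤ n → (n C k) * (k ! * (n ∸ k) !) ≡ n !
nCk*k![n∸k]!≡n! {n} {k} k≤n = trans
  (cong (_* (k ! * (n ∸ k) !)) (nCk≡n!/k![n-k]! k≤n))
  (m/n*n≡m {{k !* (n ∸ k) !≢0}} (k![n∸k]!∣n! k≤n))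

-- `p` divides `p !`, which is `p C k` times `k ! * (p ∸ k) !`, and both factorials have only
-- factors below `p`.
p∣pCk : Prime p → ∀ {k} → 0 < k → k < p → p ∣ p C k
p∣pCk {p@(suc p-1)} pr {k} 0<k k<p
  with euclidsLemma (p C k) (k ! * (p ∸ k) !) pr
         (subst (p ∣_) (sym (nCk*k![n∸k]!≡n! (<⇒≤ k<p))) (m∣m*n (p-1 !)))
... | inj₁ p∣C = p∣C
... | inj₂ p∣! with euclidsLemma (k !) ((p ∸ k) !) pr p∣!
...   | inj₁ p∣k! = contradiction p∣k! (p∤m! pr k k<p)
...   | inj₂ p∣[p∸k]! = contradiction p∣[p∸k]! (p∤m! pr (p ∸ k) (∸-monoʳ-< 0<k (<⇒≤ k<p)))

module _ where
  open Sum +-*-semiring using (sum; sum-init-last)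
  open Binomial +-*-commutativeSemiring using (theorem; binomialTerm)
  open import Algebra.Definitions.RawSemiring +-*-rawSemiring
    using () renaming (_×_ to _×ᵣ_; _^_ to _^ᵣ_)

  -- The binomial theorem is phrased with generic powers and multiples; this and `×ᵣ≡*` translate
  -- them to `ℕ`.
  ^ᵣ≡^ : ∀ x n → x ^ᵣ n ≡ x ^ n
  ^ᵣ≡^ x zero    = refl
  ^ᵣ≡^ x (suc n) = cong (x *_) (^ᵣ≡^ x n)

  ×ᵣ≡* : ∀ n x → n ×ᵣ x ≡ n * x
  ×ᵣ≡* zero    x = refl
  ×ᵣ≡* (suc n) x = cong (x +_) (×ᵣ≡* n x)

  ∣-sum : ∀ {n} (t : Fin n → ℕ) → (∀ i → d ∣ t i) → d ∣ sum t
  ∣-sum {n = zero}  t d∣t = _ ∣0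
  ∣-sum {n = suc n} t d∣t = ∣m∣n⇒∣m+n (d∣t zero) (∣-sum (t ∘ suc) (d∣t ∘ suc))

  -- In the binomial expansion of `(a + 1) ^ p`, all terms but the two outer ones are multiples of
  -- `p`.
  frobenius-suc : Prime p → ∀ a → ∃[ t ] suc a ^ p ≡ 1 + a ^ p + t * p
  frobenius-suc {p@(suc p-1)} pr a = quotient p∣mid , (begin
    suc a ^ p                                 ≡⟨ cong (_^ p) (+-comm 1 a) ⟩
    (a + 1) ^ p                               ≡⟨ ^ᵣ≡^ (a + 1) p ⟨
    (a + 1) ^ᵣ p                              ≡⟨ theorem p a 1 ⟩
    sum term                                  ≡⟨ cong (term zero +_) (sum-init-last (term ∘ suc)) ⟩
    term zero + (sum mid + term (suc (fromℕ p-1))) ≡⟨ cong₂ (λ u v → u + (sum mid + v)) first last ⟩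
    1 + (sum mid + a ^ p)                     ≡⟨ cong suc (+-comm (sum mid) (a ^ p)) ⟩
    1 + a ^ p + sum mid                       ≡⟨ cong (1 + a ^ p +_) (m∣n⇒n≡quotient*m p∣mid) ⟩
    1 + a ^ p + quotient p∣mid * p            ∎)
    where
    open ≡-Reasoning
    term : Fin (suc p) → ℕ
    term = binomialTerm a 1 p
    mid : Fin p-1 → ℕ
    mid i = term (suc (inject₁ i))
    p∣mid : p ∣ sum mid
    p∣mid = ∣-sum mid λ i → subst (p ∣_) (sym (×ᵣ≡* (p C suc (toℕ (inject₁ i))) _))
      (∣m⇒∣m*n _ (p∣pCk pr z<s (s<s (subst (_< p-1) (sym (toℕ-inject₁ i)) (toℕ<n i)))))
    1^ : ∀ n → 1 ^ᵣ n ≡ 1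
    1^ n = trans (^ᵣ≡^ 1 n) (^-zeroˡ n)
    first : term zero ≡ 1
    first = trans (×ᵣ≡* (p C 0) _) (trans (*-identityˡ _) (trans (*-identityˡ _) (1^ p)))
    last : term (suc (fromℕ p-1)) ≡ a ^ p
    last rewrite toℕ-fromℕ p-1 = trans (×ᵣ≡* (p C p) _) (trans (cong₂ _*_ (nCn≡1 p)
      (cong₂ _*_ (^ᵣ≡^ a p) (1^ (p ∸ p)))) (trans (*-identityˡ _) (*-identityʳ _)))

a^p≡a : Prime p → ∀ a → ∃[ t ] a ^ p ≡ a + t * p
a^p≡a {suc _} pr zero    = 0 , refl
a^p≡a {p}     pr (suc a) with frobenius-suc pr a | a^p≡a pr a
... | s , [1+a]^p≡ | t , a^p≡ = t + s , trans [1+a]^p≡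
  (trans (cong (λ z → 1 + z + s * p) a^p≡) (collect a t s p))
  where
  collect : ∀ a t s p → 1 + (a + t * p) + s * p ≡ suc a + (t + s) * p
  collect = solve-∀

fermat-little : Prime p → ∀ a → p ∤ a → a ^ (p ∸ 1) ≡1[mod p ]
fermat-little           pr zero       p∤a = contradiction (_ ∣0) p∤a
fermat-little {suc p-1} pr a@(suc _) p∤a = ≡1-of-multiple (a ^ p-1) (m^n>0 a p-1) (a^p≡a pr a)
  where
  ≡1-of-multiple : ∀ b → 0 < b → ∃[ t ] a * b ≡ a + t * suc p-1 → b ≡1[mod suc p-1 ]
  -- Writing the number as `suc c` turns the equation into `a * c ≡ t * suc p-1`, and `p ∤ a` leaves
  -- only `c` to be divisible.
  ≡1-of-multiple (suc c) _ (t , a*b≡)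
    with euclidsLemma a c pr (divides t (+-cancelˡ-≡ a _ _ (trans (sym (*-suc a c)) a*b≡)))
  ... | inj₁ p∣a            = contradiction p∣a p∤a
  ... | inj₂ (divides q c≡) = q , cong suc c≡

-- Parity and odd parts.

odd⇒1+2* : ∀ {n} → Odd n → ∃[ z ] n ≡ 1 + z * 2
odd⇒1+2* {n} odd with n % 2 in eq | m%n<n n 2 | m≡m%n+[m/n]*n n 2
... | zero        | _               | _  = contradiction (m%n≡0⇒n∣m n 2 eq) odd
... | suc zero    | _               | n≡ = n / 2 , n≡
... | suc (suc _) | s≤s (s≤s ())    | _

1+2*-odd : ∀ z → Odd (1 + z * 2)
1+2*-odd z 2∣ = contradiction (∣1⇒≡1 (∣m+n∣m⇒∣n (subst (2 ∣_) (+-comm 1 (z * 2)) 2∣) (n∣m*n z))) λ ()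

odd-∣ : a ∣ b → Odd b → Odd a
odd-∣ a∣b odd 2∣a = odd (∣-trans 2∣a a∣b)

prime-odd-∤2^ : Prime p → Odd p → ∀ e → p ∤ 2 ^ e
prime-odd-∤2^ pr odd zero    p∣ = nonTrivial⇒≢1 {{prime⇒nonTrivial pr}} (∣1⇒≡1 p∣)
prime-odd-∤2^ pr odd (suc e) p∣ with euclidsLemma 2 (2 ^ e) pr p∣
... | inj₂ p∣2^e = prime-odd-∤2^ pr odd e p∣2^e
... | inj₁ p∣2 with prime⇒irreducible prime[2] p∣2
...   | inj₁ refl = ¬prime[1] pr
...   | inj₂ refl = odd ∣-refl

2-power*odd-part : ∀ n → NonZero n → ∃[ e ] ∃[ m ] Odd m × n ≡ 2 ^ e * m
2-power*odd-part = <-rec _ go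
  where
  go : ∀ n → (∀ {i} → i < n → NonZero i → ∃[ e ] ∃[ m ] Odd m × i ≡ 2 ^ e * m) →
       NonZero n → ∃[ e ] ∃[ m ] Odd m × n ≡ 2 ^ e * m
  go n rec n≢0 with 2 ∣? n
  ... | no  odd = 0 , n , odd , sym (*-identityˡ n)
  ... | yes 2∣n with rec (quotient-< 2∣n {{_}} {{n≢0}}) (quotient≢0 2∣n {{n≢0}})
  ...   | e , m , odd , q≡ = suc e , m , odd ,
    trans (m∣n⇒n≡m*quotient 2∣n) (trans (cong (2 *_) q≡) (sym (*-assoc 2 (2 ^ e) m)))

-- Prime divisors of `x ^ (2 ^ n) + 1`.

-- Modulo `p`, `a` is -1, and so is each odd power of it. The induction raises the exponent by 2.
∣a+1⇒∣a^m+1 : ∀ {m} → Odd m → p ∣ a + 1 → p ∣ a ^ m + 1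
∣a+1⇒∣a^m+1 {p} {a} odd p∣ with odd⇒1+2* odd
... | z , refl = go z
  where
  -- `p` divides the left side and `a * (a + 1)`, hence also the last summand, which is the next
  -- case.
  step : ∀ a y → a * a * (y + 1) + (a + 1) ≡ a * (a + 1) + (a * (a * y) + 1)
  step = solve-∀
  go : ∀ z → p ∣ a ^ (1 + z * 2) + 1
  go zero    = subst (λ b → p ∣ b + 1) (sym (*-identityʳ a)) p∣
  go (suc z) = ∣m+n∣m⇒∣n
    (subst (p ∣_) (step a (a ^ (1 + z * 2))) (∣m∣n⇒∣m+n (∣n⇒∣m*n (a * a) (go z)) p∣))
    (∣n⇒∣m*n a p∣)

∣^ : ∀ n .{{_ : NonZero n}} → a ∣ b → a ∣ b ^ n
∣^ {b = b} (suc n) a∣b = ∣m⇒∣m*n (b ^ n) a∣b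

∣a^n+1⇒∤a : Prime p → ∀ n .{{_ : NonZero n}} → p ∣ a ^ n + 1 → p ∤ a
∣a^n+1⇒∤a pr n p∣ p∣a = nonTrivial⇒≢1 {{prime⇒nonTrivial pr}} (∣1⇒≡1 (∣m+n∣m⇒∣n p∣ (∣^ n p∣a)))

-- If 2^e is the exact power of 2 in p - 1 and e ≤ n, then raising x to
-- 2^n · m with m the odd part of p - 1 gives both 1 and -1.
∣x^2^n+1⇒≡1 : Prime p → Odd p → ∀ x n → p ∣ x ^ (2 ^ n) + 1 → p ≡1[mod 2 ^ suc n ]
∣x^2^n+1⇒≡1 {suc zero} pr _ _ _ _ = contradiction pr ¬prime[1]
∣x^2^n+1⇒≡1 {p@(suc p-1@(suc _))} pr p-odd x n p∣ with 2-power*odd-part p-1 _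
... | e , m , odd , p-1≡ with suc n ≤? e
...   | yes n<e = quotient 2^∣ , cong suc (m∣n⇒n≡quotient*m 2^∣)
  where
  2^∣ : 2 ^ suc n ∣ p-1
  2^∣ = subst (2 ^ suc n ∣_) (sym p-1≡)
    (∣m⇒∣m*n m (subst (λ k → 2 ^ suc n ∣ 2 ^ k) (m+[n∸m]≡n n<e)
      (subst (2 ^ suc n ∣_) (sym (^-distribˡ-+-* 2 (suc n) (e ∸ suc n))) (m∣m*n _))))
...   | no  n≮e = contradiction p∣2 (prime-odd-∤2^ pr p-odd 1)
  where
  open ≡-Reasoning
  r = n ∸ e
  exponent : ∀ u v m → u * m * v ≡ u * v * m
  exponent = solve-∀
  power : (x ^ p-1) ^ (2 ^ r) ≡ (x ^ (2 ^ n)) ^ m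
  power = begin
    (x ^ p-1) ^ (2 ^ r)     ≡⟨ ^-*-assoc x p-1 (2 ^ r) ⟩
    x ^ (p-1 * 2 ^ r)       ≡⟨ cong (λ k → x ^ (k * 2 ^ r)) p-1≡ ⟩
    x ^ (2 ^ e * m * 2 ^ r) ≡⟨ cong (x ^_) (exponent (2 ^ e) (2 ^ r) m) ⟩
    x ^ (2 ^ e * 2 ^ r * m) ≡⟨ cong (λ k → x ^ (k * m)) (^-distribˡ-+-* 2 e r) ⟨
    x ^ (2 ^ (e + r) * m)   ≡⟨ cong (λ k → x ^ (2 ^ k * m)) (m+[n∸m]≡n (≮⇒≥ n≮e)) ⟩
    x ^ (2 ^ n * m)         ≡⟨ ^-*-assoc x (2 ^ n) m ⟨
    (x ^ (2 ^ n)) ^ m       ∎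
  p∣2 : p ∣ 2
  p∣2 with ^-≡1 (2 ^ r) (fermat-little pr x (∣a^n+1⇒∤a pr (2 ^ n) {{m^n≢0 2 n}} p∣))
  ... | t , ≡1 = ∣m+n∣m⇒∣n {m = t * p}
    (subst (p ∣_) (trans (cong (_+ 1) (trans (sym power) ≡1)) (shift (t * p)))
      (∣a+1⇒∣a^m+1 odd p∣))
    (n∣m*n t)
    where
    shift : ∀ s → 1 + s + 1 ≡ s + 2
    shift = solve-∀

-- Powers of `3 * y ^ 4` modulo powers of 2.

odd⇒y^4≡1 : ∀ {y} → Odd y → y ^ 4 ≡1[mod 8 ]
odd⇒y^4≡1 {y} odd with odd⇒1+2* odd
-- The witness is the expansion of `((1 + 2z)^4 - 1) / 8`.
... | z , refl = z + 3 * (z * z) + 4 * (z * z * z) + 2 * (z * z * z * z) , expand z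
  where
  expand : ∀ z → (1 + z * 2) * ((1 + z * 2) * ((1 + z * 2) * ((1 + z * 2) * 1)))
           ≡ 1 + (z + 3 * (z * z) + 4 * (z * z * z) + 2 * (z * z * z * z)) * 8
  expand = solve-∀

-- Since 3y⁴ ≡ 3 (mod 8), its (2^n)-th power is 1 plus exactly 2^(n+2).
[3y⁴]^2^n : ∀ {y} → Odd y → ∀ j →
            ∃[ u ] Odd u × (3 * y ^ 4) ^ (2 ^ suc j) ≡ 1 + u * 2 ^ (3 + j)
[3y⁴]^2^n {y} odd zero with odd⇒y^4≡1 odd
... | s , y⁴≡ = 1 + (9 * s + 36 * (s * s)) * 2 , 1+2*-odd (9 * s + 36 * (s * s)) ,
  trans (cong (λ w → (3 * w) ^ 2) y⁴≡) (collect s)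
  where
  collect : ∀ s → (3 * (1 + s * 8)) * ((3 * (1 + s * 8)) * 1)
            ≡ 1 + (1 + (9 * s + 36 * (s * s)) * 2) * 8
  collect = solve-∀
[3y⁴]^2^n {y} odd (suc j) with [3y⁴]^2^n odd j
... | u , odd-u , x^≡ with odd⇒1+2* odd-u
-- Squaring `1 + u * 2 ^ (3 + j)` gives `2 ^ (4 + j)` the multiplier `u + 4 * u * u * 2 ^ j`, which
-- is odd because `u` is.
...   | z , refl = _ , 1+2*-odd (z + u * u * 2 ^ (1 + j)) , (begin
  x ^ (2 * 2 ^ suc j)                      ≡⟨ cong (x ^_) (*-comm 2 (2 ^ suc j)) ⟩
  x ^ (2 ^ suc j * 2)                      ≡⟨ ^-*-assoc x (2 ^ suc j) 2 ⟨
  (x ^ (2 ^ suc j)) ^ 2                    ≡⟨ cong (_^ 2) x^≡ ⟩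
  (1 + u * 2 ^ (3 + j)) ^ 2                ≡⟨ square z (2 ^ j) ⟩
  1 + (1 + (z + u * u * 2 ^ (1 + j)) * 2) * 2 ^ (4 + j) ∎)
  where
  open ≡-Reasoning
  x = 3 * y ^ 4
  square : ∀ z w → (1 + (1 + z * 2) * (2 * (2 * (2 * w)))) * ((1 + (1 + z * 2) * (2 * (2 * (2 * w)))) * 1)
           ≡ 1 + (1 + (z + (1 + z * 2) * (1 + z * 2) * (2 * w)) * 2) * (2 * (2 * (2 * (2 * w))))
  square = solve-∀

-- Primes with a prescribed power of 2 in `p - 1`.

-- If all multipliers `t` were even, every factor, and by `*-≡1` the product, would be 1 modulo
-- `2 * d`.
exact-factor : ∀ {qs} → All (_≡1[mod d ]) qs → ¬ product qs ≡1[mod 2 * d ] →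
               ∃[ q ] q ∈ qs × ∃[ m ] Odd m × q ≡ 1 + m * d
exact-factor []                       ≢1 = contradiction (0 , refl) ≢1
exact-factor {d} (_∷_ {x = q} (t , q≡) qs≡1) ≢1 with 2 ∣? t
... | no  odd              = q , here refl , t , odd , q≡
-- An even multiplier makes `q` congruent to 1 modulo `2 * d`, so the product of the remaining
-- factors still is not.
... | yes (divides c refl) with exact-factor qs≡1 (≢1 ∘ *-≡1 (c , trans q≡ (cong suc (*-assoc c 2 d))))
...   | r , r∈ , rest      = r , there r∈ , rest

1+odd*d-≢1 : ∀ {u} .{{_ : NonZero d}} → Odd u → ¬ 1 + u * d ≡1[mod 2 * d ]
1+odd*d-≢1 {d} {u} odd (t , eq) = odd (divides t
  (*-cancelʳ-≡ u (t * 2) d (trans (suc-injective eq) (sym (*-assoc t 2 d)))))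

m≤n⇒m∣n! : .{{_ : NonZero a}} → a ≤ b → a ∣ b !
m≤n⇒m∣n! {suc a} a≤b = ∣-trans (m∣m*n (a !)) (m≤n⇒m!∣n! a≤b)

-- An odd prime up to `M` divides `M !`, hence `y`, hence `3 * y ^ 4`; then it cannot divide a
-- positive power of this plus 1.
∣[3y⁴]^n+1⇒> : ∀ M e y → M ! ≡ 2 ^ e * y → Prime p → Odd p →
               ∀ n .{{_ : NonZero n}} → p ∣ (3 * y ^ 4) ^ n + 1 → M < p
∣[3y⁴]^n+1⇒> {p} M e y M!≡ pr odd n p∣ = ≰⇒> λ p≤M →
  [ prime-odd-∤2^ pr odd e
  , (λ p∣y → ∣a^n+1⇒∤a pr n p∣ (∣n⇒∣m*n 3 (∣^ 4 p∣y)))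
  ]′ (euclidsLemma (2 ^ e) y pr (subst (p ∣_) M!≡ (m≤n⇒m∣n! {{prime⇒nonZero pr}} p≤M)))

prime-with-exact-2-power : ∀ j M →
  ∃[ p ] Prime p × M < p × ∃[ m ] Odd m × p ≡ 1 + m * 2 ^ (2 + j)
prime-with-exact-2-power j M with 2-power*odd-part (M !) (M !≢0)
... | e , y , y-odd , M!≡ with [3y⁴]^2^n y-odd j
...   | u , u-odd , x^≡ =
  let (q , q∈ , m , m-odd , q≡) = found
  in q , q-prime q∈
   , ∣[3y⁴]^n+1⇒> M e y M!≡ (q-prime q∈) (q-odd q∈) (2 ^ suc j) {{m^n≢0 2 (suc j)}} (∣x^+1 q∈)
   , m , m-odd , q≡
  where
  x = 3 * y ^ 4
  -- Half of `x ^ (2 ^ suc j) + 1`, because this power of `x` is `1 + u * 2 ^ (3 + j)`.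
  K = 1 + u * 2 ^ (2 + j)
  open PrimeFactorisation (factorise K)

  x^+1≡K*2 : x ^ (2 ^ suc j) + 1 ≡ K * 2
  x^+1≡K*2 = trans (cong (_+ 1) x^≡) (halve u (2 ^ (2 + j)))
    where
    halve : ∀ u w → 1 + u * (2 * w) + 1 ≡ (1 + u * w) * 2
    halve = solve-∀

  K-odd : Odd K
  K-odd = subst (λ n → Odd (1 + n)) (shift u (2 ^ (1 + j))) (1+2*-odd (u * 2 ^ (1 + j)))
    where
    shift : ∀ u w → u * w * 2 ≡ u * (2 * w)
    shift = solve-∀

  q-prime : ∀ {q} → q ∈ factors → Prime q
  q-prime = All.lookup factorsPrime

  ∣K : ∀ {q} → q ∈ factors → q ∣ K
  ∣K {q} q∈ = subst (q ∣_) (sym isFactorisation) (∈⇒∣product q∈)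

  q-odd : ∀ {q} → q ∈ factors → Odd q
  q-odd q∈ = odd-∣ (∣K q∈) K-odd

  ∣x^+1 : ∀ {q} → q ∈ factors → q ∣ x ^ (2 ^ suc j) + 1
  ∣x^+1 {q} q∈ = subst (q ∣_) (sym x^+1≡K*2) (∣m⇒∣m*n 2 (∣K q∈))

  found : ∃[ q ] q ∈ factors × ∃[ m ] Odd m × q ≡ 1 + m * 2 ^ (2 + j)
  -- Each prime factor is 1 modulo `2 ^ (2 + j)`, but `K` is not 1 modulo `2 ^ (3 + j)`, since `u`
  -- is odd.
  found = exact-factor
    (All.tabulate λ q∈ → ∣x^2^n+1⇒≡1 (q-prime q∈) (q-odd q∈) x (suc j) (∣x^+1 q∈))
    (subst (λ n → ¬ n ≡1[mod 2 ^ (3 + j) ]) isFactorisation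
      (1+odd*d-≢1 {{m^n≢0 2 (2 + j)}} u-odd))

-- The greatest odd divisor of `m * 2 ^ e`.

odd∣m*2^e⇒∣m : ∀ {m} → Odd d → ∀ e → d ∣ m * 2 ^ e → d ∣ m
odd∣m*2^e⇒∣m {d} {m} odd zero    d∣ = subst (d ∣_) (*-identityʳ m) d∣
odd∣m*2^e⇒∣m {d} {m} odd (suc e) d∣ = odd∣m*2^e⇒∣m odd e
  (coprime-divisor coprime (subst (d ∣_) (move m (2 ^ e)) d∣))
  where
  move : ∀ m w → m * (2 * w) ≡ 2 * (m * w)
  move = solve-∀
  coprime : Coprime d 2
  coprime (i∣d , i∣2) with prime⇒irreducible prime[2] i∣2
  ... | inj₁ i≡1  = i≡1
  ... | inj₂ refl = contradiction i∣d odd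

-- Every odd divisor of `m * 2 ^ e` divides `m`, and `m` is itself one of them.
greatestOddDivisor[m*2^e]≡m : ∀ {m} .{{_ : NonZero m}} → Odd m → ∀ e →
                              greatestOddDivisor (m * 2 ^ e) ≡ m
greatestOddDivisor[m*2^e]≡m {m} odd e = ≤-antisym
  (∣⇒≤ (odd∣m*2^e⇒∣m (proj₁ isOddDivisor) e (proj₂ isOddDivisor)))
  (greatestOddDivisor-greatest (m * 2 ^ e) {{m*n≢0 m (2 ^ e)}} odd (m∣m*n (2 ^ e)))
  where
  instance
    _ = m^n≢0 2 e
  isOddDivisor = greatestOddDivisor-isOddDivisor (m * 2 ^ e)

odd⇒nonZero : ∀ {m} → Odd m → NonZero m
odd⇒nonZero odd = ≢-nonZero λ { refl → odd (2 ∣0) }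

m≡n*o⇒m/o≡n : ∀ {m o} n .{{_ : NonZero o}} → m ≡ n * o → m / o ≡ n
m≡n*o⇒m/o≡n {o = o} n refl = m*n/n≡m n o

-- Roots of integer polynomials.

evalℤ : List ℤ → ℤ → ℤ
evalℤ []       x = 0ℤ
evalℤ (c ∷ cs) x = c ℤ.+ x ℤ.* evalℤ cs x

Zero : List ℤ → Set
Zero = All (_≡ 0ℤ)

evalℤ-zero : ∀ {cs} → Zero cs → ∀ x → evalℤ cs x ≡ 0ℤ
evalℤ-zero []            x = refl
evalℤ-zero (refl ∷ cs≡0) x =
  trans (ℤ.+-identityˡ _) (trans (cong (x ℤ.*_) (evalℤ-zero cs≡0 x)) (ℤ.*-zeroʳ x))

zero-head : ∀ c cs a → Zero cs → evalℤ (c ∷ cs) a ≡ 0ℤ → c ≡ 0ℤ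
zero-head c cs a cs≡0 eval≡0 = trans (sym (ℤ.+-identityʳ c))
  (trans (cong (ℤ._+_ c) (sym (trans (cong (a ℤ.*_) (evalℤ-zero cs≡0 a)) (ℤ.*-zeroʳ a)))) eval≡0)

-- The quotient of c ∷ cs by x - a, which does not depend on c.
syntheticQuotient : ℤ → List ℤ → List ℤ
syntheticQuotient a []       = []
syntheticQuotient a (c ∷ cs) = evalℤ (c ∷ cs) a ∷ syntheticQuotient a cs

length-syntheticQuotient : ∀ a cs → length (syntheticQuotient a cs) ≡ length cs
length-syntheticQuotient a []       = refl
length-syntheticQuotient a (c ∷ cs) = cong suc (length-syntheticQuotient a cs)

-- The constant term cancels. What is left, `x * u - a * v`, splits as `(x - a) * v + x * (u - v)`,
-- and induction treats `u - v`.
syntheticQuotient-correct : ∀ a c cs x →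
  evalℤ (c ∷ cs) x ℤ.- evalℤ (c ∷ cs) a ≡ (x ℤ.- a) ℤ.* evalℤ (syntheticQuotient a cs) x
syntheticQuotient-correct a c []        x = constant a c x
  where
  constant : ∀ a c x → c ℤ.+ x ℤ.* 0ℤ ℤ.- (c ℤ.+ a ℤ.* 0ℤ) ≡ (x ℤ.- a) ℤ.* 0ℤ
  constant = ℤ-Solver.solve-∀
syntheticQuotient-correct a c (c′ ∷ cs) x =
  trans (split a c x u v) (trans
    (cong (λ w → (x ℤ.- a) ℤ.* v ℤ.+ x ℤ.* w) (syntheticQuotient-correct a c′ cs x))
    (factor a x v _))
  where
  u = evalℤ (c′ ∷ cs) x
  v = evalℤ (c′ ∷ cs) a
  split : ∀ a c x u v → c ℤ.+ x ℤ.* u ℤ.- (c ℤ.+ a ℤ.* v) ≡ (x ℤ.- a) ℤ.* v ℤ.+ x ℤ.* (u ℤ.- v)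
  split = ℤ-Solver.solve-∀
  factor : ∀ a x v r → (x ℤ.- a) ℤ.* v ℤ.+ x ℤ.* ((x ℤ.- a) ℤ.* r) ≡ (x ℤ.- a) ℤ.* (v ℤ.+ x ℤ.* r)
  factor = ℤ-Solver.solve-∀

-- Coefficients vanish from the highest degree down: once `cs` is zero, the value of `c ∷ cs` at `a`
-- is `c`.
syntheticQuotient-zero : ∀ a cs → Zero (syntheticQuotient a cs) → Zero cs
syntheticQuotient-zero a []       []         = []
syntheticQuotient-zero a (c ∷ cs) (v≡0 ∷ q≡0) = zero-head c cs a cs≡0 v≡0 ∷ cs≡0
  where
  cs≡0 = syntheticQuotient-zero a cs q≡0

-- Dividing by `x - h 0` leaves a shorter polynomial with the roots `h ∘ suc`. The recursion is on
-- the length `n`, because the quotient is not a structural part of `cs`.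
infinitely-many-roots⇒zero : ∀ n cs → length cs ≡ n → (h : ℕ → ℤ) → Injective _≡_ _≡_ h →
                             (∀ m → evalℤ cs (h m) ≡ 0ℤ) → Zero cs
infinitely-many-roots⇒zero zero    []       _   h inj root = []
infinitely-many-roots⇒zero (suc n) (c ∷ cs) len h inj root = zero-head c cs (h 0) cs≡0 (root 0) ∷ cs≡0
  where
  quotient-root : ∀ m → evalℤ (syntheticQuotient (h 0) cs) (h (suc m)) ≡ 0ℤ
  quotient-root m with ℤ.i*j≡0⇒i≡0∨j≡0 (h (suc m) ℤ.- h 0)
    (trans (sym (syntheticQuotient-correct (h 0) c cs (h (suc m)))) (cong₂ ℤ._-_ (root (suc m)) (root 0)))
  ... | inj₂ root′ = root′
  ... | inj₁ same  = contradiction (inj (ℤ.i-j≡0⇒i≡j (h (suc m)) (h 0) same)) λ ()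

  cs≡0 : Zero cs
  cs≡0 = syntheticQuotient-zero (h 0) cs (infinitely-many-roots⇒zero n (syntheticQuotient (h 0) cs)
    (trans (length-syntheticQuotient (h 0) cs) (suc-injective len))
    (h ∘ suc) (suc-injective ∘ inj) quotient-root)

-- Clearing denominators.

denominator : ℚ[x] → ℕ
denominator []       = 1
denominator (q ∷ qs) = ↧ₙ q * denominator qs

-- These are the coefficients of `g` multiplied by `denominator g`: `↧ q` cancels in the head and
-- remains as a factor of the tail.
numerators : ℚ[x] → List ℤ
numerators []       = []
numerators (q ∷ qs) = ↥ q ℤ.* ℤ.+ denominator qs ∷ map (ℤ._*_ (↧ q)) (numerators qs)

denominator-nonZero : ∀ g → NonZero (denominator g)
denominator-nonZero []       = _
denominator-nonZero (q ∷ qs) = m*n≢0 (↧ₙ q) (denominator qs) {{_}} {{denominator-nonZero qs}}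

evalℤ-scale : ∀ d cs x → evalℤ (map (ℤ._*_ d) cs) x ≡ d ℤ.* evalℤ cs x
evalℤ-scale d []       x = sym (ℤ.*-zeroʳ d)
evalℤ-scale d (c ∷ cs) x = trans (cong (λ w → d ℤ.* c ℤ.+ x ℤ.* w) (evalℤ-scale d cs x)) (pull d c x _)
  where
  pull : ∀ d c x w → d ℤ.* c ℤ.+ x ℤ.* (d ℤ.* w) ≡ d ℤ.* (c ℤ.+ x ℤ.* w)
  pull = ℤ-Solver.solve-∀

zero-scale : ∀ d cs → d ≢ 0ℤ → Zero (map (ℤ._*_ d) cs) → Zero cs
zero-scale d []       d≢0 []            = []
zero-scale d (c ∷ cs) d≢0 (dc≡0 ∷ dcs≡0) with ℤ.i*j≡0⇒i≡0∨j≡0 d dc≡0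
... | inj₁ d≡0 = contradiction d≡0 d≢0
... | inj₂ c≡0 = c≡0 ∷ zero-scale d cs d≢0 dcs≡0

zero-numerators : ∀ g → Zero (numerators g) → All (_≡ 0ℚ) g
zero-numerators []       []          = []
zero-numerators (q ∷ qs) (n≡0 ∷ ns≡0) with ℤ.i*j≡0⇒i≡0∨j≡0 (↥ q) n≡0
... | inj₁ ↥q≡0 = ℚ.↥p≡0⇒p≡0 q ↥q≡0 ∷ zero-numerators qs (zero-scale (↧ q) (numerators qs) (λ ()) ns≡0)
... | inj₂ D≡0  = contradiction (ℤ.+-injective D≡0) (≢-nonZero⁻¹ _ {{denominator-nonZero qs}})

-- Reasoning over an abstract ring avoids conversion problems in which eval 𝒜
-- unfolds to very large terms.
module _ {c ℓ} (A : CommutativeRing c ℓ)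
         (φ : RingHomomorphism (CommutativeRing.rawRing ℚ-ring) (CommutativeRing.rawRing A)) where
  private
    module A = CommutativeRing A
    module φ = RingHomomorphism φ

  eval-elim : ∀ {ℓ′} α (P : ℚ[x] → A.Carrier → Set ℓ′) → P [] A.0# →
              (∀ q qs {y} → P qs y → P (q ∷ qs) (φ.⟦ q ⟧ A.+ α A.* y)) →
              ∀ g → P g (eval A φ g α)
  eval-elim α P base step []       = base
  eval-elim α P base step (q ∷ qs) = step q qs (eval-elim α P base step qs)

-- `fromℚ` is known to invert a denominator modulo `p` when `p` does not divide it, so denominators
-- are cleared for primes not dividing their product.
eval-numerators : ∀ (α : ℙ → ℤ) p g → value p ∤ denominator g →
  ℤ.+ value p ℤ∣.∣ ℤ.+ denominator g ℤ.* eval 𝒜 ℚ→𝒜 g α p ℤ.- evalℤ (numerators g) (α p)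
eval-numerators α p = eval-elim 𝒜 ℚ→𝒜 α
  (λ g y → value p ∤ denominator g →
    ℤ.+ value p ℤ∣.∣ ℤ.+ denominator g ℤ.* y p ℤ.- evalℤ (numerators g) (α p))
  (λ _ → ℤ∣.divides 0ℤ refl)
  (λ q qs {y} ih p∤ → clear (↧ q) (ℤ.+ denominator qs) (fromℚ q p) (↥ q) (α p) (y p)
    (evalℤ (numerators qs) (α p))
    (ℤ.pos-* (↧ₙ q) (denominator qs)) (evalℤ-scale (↧ q) (numerators qs) (α p))
    (fromℚ-correct p q (p∤ ∘ ∣m⇒∣m*n (denominator qs)))
    (ih (p∤ ∘ ∣n⇒∣m*n (↧ₙ q))))
  where
  expand : ∀ d D Q n x E G → D ℤ.* (d ℤ.* Q ℤ.- n) ℤ.+ x ℤ.* d ℤ.* (D ℤ.* E ℤ.- G)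
           ≡ d ℤ.* D ℤ.* (Q ℤ.+ x ℤ.* E) ℤ.- (n ℤ.* D ℤ.+ x ℤ.* (d ℤ.* G))
  expand = ℤ-Solver.solve-∀

  -- `dD` and `dG` stand for terms of `q ∷ qs` that equal `d * D` and `d * G` only propositionally.
  clear : ∀ {r dD dG} d D Q n x E G → dD ≡ d ℤ.* D → dG ≡ d ℤ.* G →
          r ℤ∣.∣ d ℤ.* Q ℤ.- n → r ℤ∣.∣ D ℤ.* E ℤ.- G →
          r ℤ∣.∣ dD ℤ.* (Q ℤ.+ x ℤ.* E) ℤ.- (n ℤ.* D ℤ.+ x ℤ.* dG)
  clear {r} d D Q n x E G refl refl r∣Q r∣E = subst (r ℤ∣.∣_) (expand d D Q n x E G)
    (ℤ∣.∣m∣n⇒∣m+n (ℤ∣.∣n⇒∣m*n D r∣Q) (ℤ∣.∣n⇒∣m*n (x ℤ.* d) r∣E))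

-- Vanishing at powers of 2, and transcendence.

multiple-of-larger⇒0 : ∀ {n} z → ℤ.∣ z ∣ < n → ℤ.+ n ℤ∣.∣ z → z ≡ 0ℤ
multiple-of-larger⇒0 z z<n n∣z with ℤ.∣ z ∣ in eq | ℤ∣.∣⇒∣ᵤ n∣z
... | zero  | _     = ℤ.∣i∣≡0⇒i≡0 eq
... | suc _ | n∣∣z∣ = contradiction n∣∣z∣ (>⇒∤ z<n)

exact-2-power : ℙ → ℕ
exact-2-power p = _/_ (value p ∸ 1) (k p) {{k-nonZero p}}

exact-2-power≡2^ : ∀ p {m} → Odd m → ∀ e → value p ≡ 1 + m * 2 ^ e → exact-2-power p ≡ 2 ^ e
exact-2-power≡2^ p {m} odd e p≡ = m≡n*o⇒m/o≡n {o = k p} (2 ^ e) {{k-nonZero p}}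
  (trans p-1≡ (trans (*-comm m (2 ^ e)) (cong (2 ^ e *_) (sym k≡m))))
  where
  p-1≡ : value p ∸ 1 ≡ m * 2 ^ e
  p-1≡ = cong (_∸ 1) p≡
  k≡m : k p ≡ m
  k≡m = trans (cong greatestOddDivisor p-1≡) (greatestOddDivisor[m*2^e]≡m {{odd⇒nonZero odd}} odd e)

max<⇒∉ : ∀ P S → max 0 (map value S) < value P → P ∉ S
max<⇒∉ P S max<P P∈S = <⇒≱ max<P (All.lookup (xs≤max 0 (map value S)) (∈-map⁺ value P∈S))

prime-outside-with-exact-2-power : ∀ j M S →
  ∃[ P ] P ∉ S × M < value P × ∃[ m ] Odd m × value P ≡ 1 + m * 2 ^ (2 + j)
prime-outside-with-exact-2-power j M S =
  let max = max 0 (map value S)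
      -- Exceeding the sum puts the prime beyond `M` and beyond every element of `S`.
      (q , q-prime , max+M<q , q≡) = prime-with-exact-2-power j (max + M)
      P = mkℙ q q-prime
  in P , max<⇒∉ P S (≤-<-trans (m≤m+n max M) max+M<q) , ≤-<-trans (m≤n+m M max) max+M<q , q≡

2^-injective : Injective _≡_ _≡_ (2 ^_)
2^-injective {i} {j} eq with <-cmp i j
... | tri< i<j _ _ = contradiction eq (<⇒≢ (^-monoʳ-< 2 (s<s z<s) i<j))
... | tri≈ _ i≡j _ = i≡j
... | tri> _ _ i>j = contradiction (sym eq) (<⇒≢ (^-monoʳ-< 2 (s<s z<s) i>j))

∣eval⇒∣evalℤ : ∀ (α : ℙ → ℤ) p g → value p ∤ denominator g →
  ℤ.+ value p ℤ∣.∣ eval 𝒜 ℚ→𝒜 g α p → ℤ.+ value p ℤ∣.∣ evalℤ (numerators g) (α p)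
∣eval⇒∣evalℤ α p g p∤D = divides-second
  (ℤ.+ denominator g) (eval 𝒜 ℚ→𝒜 g α p) (evalℤ (numerators g) (α p)) (eval-numerators α p g p∤D)
  where
  u-[u-v]≡v : ∀ u v → u ℤ.- (u ℤ.- v) ≡ v
  u-[u-v]≡v = ℤ-Solver.solve-∀
  divides-second : ∀ {r} D E G → r ℤ∣.∣ D ℤ.* E ℤ.- G → r ℤ∣.∣ E → r ℤ∣.∣ G
  divides-second {r} D E G r∣ r∣E = subst (r ℤ∣.∣_) (u-[u-v]≡v (D ℤ.* E) G)
    (ℤ∣.∣m∣n⇒∣m-n (ℤ∣.∣n⇒∣m*n D r∣E) r∣)

-- The two nested quotients unfold the equation to divisibility of `y p - 0 - 0`, one subtraction
-- for each.
≈0⇒∣ : ∀ y → CommutativeRing._≈_ 𝒜 y (CommutativeRing.0# 𝒜) →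
       ∃[ S ] (∀ p → p ∉ S → ℤ.+ value p ℤ∣.∣ y p)
≈0⇒∣ y (S , y≈0) = S , λ p p∉S →
  subst (ℤ.+ value p ℤ∣.∣_) (trans (ℤ.+-identityʳ _) (ℤ.+-identityʳ (y p))) (y≈0 p p∉S)

zero-at-2-powers : ∀ (f : ℕ → ℤ) g →
  CommutativeRing._≈_ 𝒜 (eval 𝒜 ℚ→𝒜 g (f ∘ exact-2-power)) (CommutativeRing.0# 𝒜) →
  ∀ j → evalℤ (numerators g) (f (2 ^ (2 + j))) ≡ 0ℤ
zero-at-2-powers f g eval≈0 j =
  let D = denominator g
      v = evalℤ (numerators g) (f (2 ^ (2 + j)))
      (S , vanishes) = ≈0⇒∣ (eval 𝒜 ℚ→𝒜 g (f ∘ exact-2-power)) eval≈0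
      -- `v` does not depend on `P`, so the bound may contain it. Beyond `D`, `P` cannot divide the
      -- denominator; beyond the absolute value of `v`, it divides `v` only if `v` is 0.
      (P , P∉S , M<P , m , m-odd , P≡) = prime-outside-with-exact-2-power j (D + ℤ.∣ v ∣) S
      P∤D = >⇒∤ {{denominator-nonZero g}} (≤-<-trans (m≤m+n D ℤ.∣ v ∣) M<P)
      P∣v = subst (λ x → ℤ.+ value P ℤ∣.∣ evalℤ (numerators g) (f x))
              (exact-2-power≡2^ P m-odd (2 + j) P≡)
              (∣eval⇒∣evalℤ (f ∘ exact-2-power) P g P∤D (vanishes P P∉S))
  in multiple-of-larger⇒0 v (≤-<-trans (m≤n+m ℤ.∣ v ∣ D) M<P) P∣v

theorem1p7 : (f : ℕ → ℤ) → Injective _≡_ _≡_ f →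
    Transcendental 𝒜 ℚ→𝒜 (image (λ p → f (_/_ (value p ∸ 1) (k p) {{k-nonZero p}})))
theorem1p7 f f-inj (g , g≢0 , eval≈0) =
  -- The values `f (2 ^ (2 + j))` are pairwise distinct roots, so all coefficients of `g` are 0,
  -- against `g≢0`.
  All¬⇒¬Any (All.map contradiction (zero-numerators g
    (infinitely-many-roots⇒zero _ (numerators g) refl (λ j → f (2 ^ (2 + j)))
      (+-cancelˡ-≡ 2 _ _ ∘ 2^-injective ∘ f-inj) (zero-at-2-powers f g eval≈0)))) g≢0
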